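{- Let $k\ge 2$ and $n>t\geq 1$ be integers. Then the number $B_k(n,t)$ of length-$n$ words over $\Sigma_k$ that have a unique border, this border having length $t$, satisfies \[ B_k(n,t)=\begin{cases} 0, & \text{if } n<2t;\\ u_t k^{n-2t}-\sum_{i=2t}^{\lfloor n/2\rfloor}B_k(i,t)k^{n-2i}, & \text{if } n\ge 2t \text{ and } n+t \text{ is odd};\\ u_t k^{n-2t}-B_k\!\left(\tfrac{n+t}{2},t\right)-\sum_{i=2t}^{\lfloor n/2\rfloor}B_k(i,t)k^{n-2i}, & \text{if } n\ge 2t \text{ and } n+t \text{ is even}. \end{cases} \]
   Context: $\Sigma_k=\{0,1,\ldots,k-1\}$. A border of a word $w$ is a non-empty word that is both a proper prefix and a proper suffix of $w$; $w$ is unbordered if it has no border. A word has a unique border if it has exactly one border. $u_t$ denotes the number of unbordered words of length $t$ over $\Sigma_k$ (with $u_0=1$, $u_n=ku_{n-1}-u_{n/2}$ for even $n>0$, $u_n=ku_{n-1}$ for odd $n$). An empty sum is zero. -}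

module Defs where

open import Data.Fin.Base using (Fin)
import Data.Fin.Properties as Fin
open import Data.List.Base
  using (List; []; _∷_; [_]; length; map; filter; inits; upTo; allFin; cartesianProductWith)
open import Data.List.Properties using (≡-dec; ∷-injective)
open import Data.List.Membership.Propositional using (_∈_; lose; find)
open import Data.List.Membership.Propositional.Properties
  using (∈-cartesianProductWith⁺; ∈-cartesianProductWith⁻; ∈-allFin; ∈-map⁺)
open import Data.List.Relation.Binary.Prefix.Heterogeneous using (Prefix; []; _∷_)
open import Data.List.Relation.Binary.Prefix.Heterogeneous.Properties using (prefix?)
open import Data.List.Relation.Binary.Suffix.Heterogeneous using (Suffix)
open import Data.List.Relation.Binary.Suffix.Heterogeneous.Properties using (suffix?)
open import Data.List.Relation.Unary.All as All using (All; all?)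
open import Data.List.Relation.Unary.Any using (Any; here; there; any?)
open import Data.List.Relation.Unary.AllPairs using ([]; _∷_)
open import Data.List.Relation.Unary.Unique.Propositional using (Unique)
import Data.List.Relation.Unary.Unique.Propositional.Properties as Unique
open import Data.Nat.Base using (ℕ; zero; suc; _+_; _∸_)
open import Data.Nat.ListAction using (sum)
open import Data.Nat.Properties using (_≟_; suc-injective)
open import Data.Product using (Σ-syntax; ∃; ∃!; _×_; _,_; proj₁)
open import Level using (0ℓ)
open import Relation.Binary.Definitions using (DecidableEquality)
open import Relation.Binary.PropositionalEquality using (_≡_; _≢_; refl; cong)
open import Relation.Nullary.Decidable using (Dec; map′; ¬?; _×-dec_; _→-dec_)
open import Relation.Nullary.Negation using (¬_)
open import Relation.Unary using (Pred; Decidable)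

Word : ℕ → Set
Word k = List (Fin k)

_≟ʷ_ : ∀ {k} → DecidableEquality (Word k)
_≟ʷ_ = ≡-dec Fin._≟_

ProperPrefix ProperSuffix : ∀ {k} → Word k → Word k → Set
ProperPrefix x w = Prefix _≡_ x w × x ≢ w
ProperSuffix x w = Suffix _≡_ x w × x ≢ w

IsBorder : ∀ {k} → Word k → Word k → Set
IsBorder x w = x ≢ [] × ProperPrefix x w × ProperSuffix x w

Unbordered : ∀ {k} → Word k → Set
Unbordered w = ¬ (∃ λ x → IsBorder x w)

HasUniqueBorder : ∀ {k} → Word k → Set
HasUniqueBorder w = ∃! _≡_ (λ x → IsBorder x w)

HasUniqueBorderOfLength : ∀ {k} → ℕ → Word k → Set
HasUniqueBorderOfLength t w = Σ[ b ∈ HasUniqueBorder w ] length (proj₁ b) ≡ t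

isBorder? : ∀ {k} (x w : Word k) → Dec (IsBorder x w)
isBorder? x w =
  ¬? (x ≟ʷ []) ×-dec
  (prefix? Fin._≟_ x w ×-dec ¬? (x ≟ʷ w)) ×-dec
  (suffix? Fin._≟_ x w ×-dec ¬? (x ≟ʷ w))

∈-inits : ∀ {k} {x w : Word k} → Prefix _≡_ x w → x ∈ inits w
∈-inits []         = here refl
∈-inits (refl ∷ p) = there (∈-map⁺ (_ ∷_) (∈-inits p))

border∈inits : ∀ {k} {x w : Word k} → IsBorder x w → x ∈ inits w
border∈inits (_ , (p , _) , _) = ∈-inits p

unbordered? : ∀ {k} → Decidable (Unbordered {k})
unbordered? w = ¬? (map′
  (λ a → let x , _ , b = find a in x , b)
  (λ (x , b) → lose (border∈inits b) b)
  (any? (λ x → isBorder? x w) (inits w)))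

hasUniqueBorderOfLength? : ∀ {k} t → Decidable (HasUniqueBorderOfLength {k} t)
hasUniqueBorderOfLength? {k} t w = map′ to from (any? candidate? (inits w))
  where
  Candidate : Word k → Set
  Candidate x =
    IsBorder x w × All (λ y → IsBorder y w → x ≡ y) (inits w) × length x ≡ t

  candidate? : Decidable Candidate
  candidate? x =
    isBorder? x w
    ×-dec all? (λ y → isBorder? y w →-dec (x ≟ʷ y)) (inits w)
    ×-dec (length x ≟ t)

  to : Any Candidate (inits w) → HasUniqueBorderOfLength t w
  to c = let x , _ , b , v , l = find c in
    (x , b , λ b′ → All.lookup v (border∈inits b′) b′) , l

  from : HasUniqueBorderOfLength t w → Any Candidate (inits w)
  from ((x , b , v) , l) =
    lose (border∈inits b) (b , All.tabulate (λ _ b′ → v b′) , l)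

words : (k n : ℕ) → List (Word k)
words k zero    = [ [] ]
words k (suc n) = cartesianProductWith _∷_ (allFin k) (words k n)

words-complete : ∀ {k} n {w : Word k} → length w ≡ n → w ∈ words k n
words-complete zero    {[]}    _  = here refl
words-complete (suc n) {a ∷ w} eq =
  ∈-cartesianProductWith⁺ _∷_ (∈-allFin a) (words-complete n (suc-injective eq))

words-sound : ∀ {k} n {w : Word k} → w ∈ words k n → length w ≡ n
words-sound     zero    (here refl) = refl
words-sound {k} (suc n) w∈
  with _ , _ , _ , v∈ , refl ← ∈-cartesianProductWith⁻ _∷_ (allFin k) (words k n) w∈
  = cong suc (words-sound n v∈)

words-unique : ∀ k n → Unique (words k n)
words-unique k zero    = All.[] ∷ []
words-unique k (suc n) =
  Unique.cartesianProductWith⁺ _∷_ ∷-injective (Unique.allFin⁺ k) (words-unique k n)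

countWords : ∀ {k} {P : Pred (Word k) 0ℓ} → Decidable P → ℕ → ℕ
countWords {k} P? n = length (filter P? (words k n))

u : ℕ → ℕ → ℕ
u k t = countWords {k} unbordered? t

B : ℕ → ℕ → ℕ → ℕ
B k n t = countWords {k} (hasUniqueBorderOfLength? t) n

-- Both bounds are inclusive; suc b ∸ a is 0 when b < a, giving the empty sum.
∑[_⋯_] : ℕ → ℕ → (ℕ → ℕ) → ℕ
∑[ a ⋯ b ] f = sum (map (λ j → f (a + j)) (upTo (suc b ∸ a)))

{-# OPTIONS --safe #-}

-- A word of length n ≥ 2t whose shortest border x has length t is x z x with x unbordered, so there
-- are u_t k^(n-2t) of them.  Classify them by their second-shortest border y, if any: y itself has x
-- as its unique border.  If |y| = i ≤ n/2 the word is y z′ y, which gives B(i,t) k^(n-2i) words; if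
-- |y| > n/2 the two copies of y overlap in a border of y, that is in x, so 2|y| = n + t and the
-- word is determined by y.

module Submission where

open import Defs
open import Data.List.Base
  using (List; []; _∷_; _++_; length; take; drop; inits; filter; map; concatMap;
         cartesianProduct; cartesianProductWith; allFin; upTo)
open import Data.List.Membership.Propositional using (_∈_; find; lose)
open import Data.List.Membership.Propositional.Properties
  using (∈-map⁺; ∈-map⁻; ∈-++⁺ˡ; ∈-++⁺ʳ; ∈-++⁻; ∈-concat⁺′; ∈-concat⁻′; ∈-filter⁺; ∈-filter⁻;
         ∈-cartesianProduct⁺; ∈-cartesianProduct⁻; ∈-upTo⁺; ∈-upTo⁻)
open import Data.List.Membership.Propositional.Properties.WithK using (unique∧set⇒bag)
open import Data.List.Properties
  using (length-++; length-take; length-drop; length-map; length-tabulate; ∷-injective; ++-assoc;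
         map-id-local; map-cong-local; map-∘; filter-none)
open import Data.List.Relation.Binary.BagAndSetEquality using (∼bag⇒↭)
open import Data.List.Relation.Binary.Disjoint.Propositional using (Disjoint)
open import Data.List.Relation.Binary.Permutation.Propositional.Properties using (↭-length)
import Data.List.Relation.Binary.Pointwise as Pointwise
open import Data.List.Relation.Binary.Prefix.Heterogeneous using (Prefix; []; _∷_)
import Data.List.Relation.Binary.Prefix.Heterogeneous as Prefix
import Data.List.Relation.Binary.Prefix.Heterogeneous.Properties as Prefix
open import Data.List.Relation.Binary.Suffix.Heterogeneous using (Suffix; here; there)
import Data.List.Relation.Binary.Suffix.Heterogeneous as Suffix
open import Data.List.Relation.Unary.All as All using (All)
import Data.List.Relation.Unary.All.Properties as All
open import Data.List.Relation.Unary.AllPairs as AllPairs using (_∷_)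
import Data.List.Relation.Unary.AllPairs.Properties as AllPairs
open import Data.List.Relation.Unary.Any using (here; there; any?)
open import Data.List.Relation.Unary.Unique.Propositional using (Unique)
import Data.List.Relation.Unary.Unique.Propositional.Properties as Unique
open import Data.Nat.Base using (ℕ; zero; suc; _+_; _*_; _∸_; _^_; _≤_; _<_; _/_; z≤n; s≤s)
open import Data.Nat.DivMod using (m*n/n≡m; m/n*n≤m; /-monoˡ-≤)
open import Data.Nat.Divisibility using (_∣_; divides)
open import Data.Nat.ListAction using (sum)
open import Data.Nat.Properties
open import Data.Integer.Base using (+_; _-_)
import Data.Integer.Properties as ℤ
open import Data.Product.Base using (_×_; _,_; ∃; Σ-syntax; proj₁; proj₂)
open import Data.Sum.Base using (_⊎_; inj₁; inj₂)
open import Function.Base using (_∘_)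
open import Function.Bundles using (mk⇔)
open import Level using (0ℓ)
open import Relation.Binary.Definitions using (tri<; tri≈; tri>)
open import Relation.Binary.PropositionalEquality
  using (_≡_; _≢_; refl; sym; trans; cong; cong₂; subst; subst₂; module ≡-Reasoning)
open import Relation.Nullary.Decidable using (Dec; yes; no; map′; ¬?; _×-dec_; decidable-stable)
open import Relation.Nullary.Negation using (¬_; contradiction)
open import Relation.Unary using (Pred; Decidable)

private variable
  k : ℕ
  w x y : Word k

-- Borders as word equations

-- Levi's lemma for free monoids, in the case where the first left factor is the shorter one.
levi : ∀ {A : Set} (a : List A) {b c d} → a ++ b ≡ c ++ d → length a ≤ length c →
       ∃ λ e → c ≡ a ++ e × b ≡ e ++ d
levi []      {c = c} eq _ = c , refl , eq
levi (x ∷ a) {c = y ∷ c} eq (s≤s a≤c)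
  with refl , eq′ ← ∷-injective eq
  with e , c≡ae , b≡ed ← levi a {c = c} eq′ a≤c = e , cong (x ∷_) c≡ae , b≡ed

-- The two cofactors are kept as data, so that overlaps of borders become word equations for `levi`;
-- properness is measured by length, the form that the counting uses.
record Border (x w : Word k) : Set where
  field
    {right left} : Word k
    prefix   : w ≡ x ++ right
    suffix   : w ≡ left ++ x
    nonempty : 0 < length x
    proper   : length x < length w
open Border

toBorder : IsBorder x w → Border x w
toBorder {x = x} {w = w} (x≢[] , (p , x≢w) , (s , _)) = record
  { prefix   = proj₂ (pre p)
  ; suffix   = proj₂ (suf s)
  ; nonempty = ≤∧≢⇒< z≤n (λ 0≡∣x∣ → x≢[] (empty x 0≡∣x∣))
  ; proper   = ≤∧≢⇒< (Prefix.length-mono p)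
                 (λ eq → x≢w (Pointwise.Pointwise-≡⇒≡ (Prefix.toPointwise eq p)))
  }
  where
  pre : ∀ {x w : Word k} → Prefix _≡_ x w → ∃ λ z → w ≡ x ++ z
  pre []         = _ , refl
  pre (refl ∷ p) = let z , eq = pre p in z , cong (_ ∷_) eq
  suf : ∀ {x w : Word k} → Suffix _≡_ x w → ∃ λ z → w ≡ z ++ x
  suf (here eq) = [] , sym (Pointwise.Pointwise-≡⇒≡ eq)
  suf (there s) = let z , eq = suf s in _ ∷ z , cong (_ ∷_) eq
  empty : ∀ (x : Word k) → 0 ≡ length x → x ≡ []
  empty [] _ = refl

fromBorder : Border x w → IsBorder x w
fromBorder {x = x} {w = w} b =
    (λ { refl → n≮n 0 (nonempty b) })
  , (subst (Prefix _≡_ x) (sym (prefix b)) (Prefix.fromView (Pointwise.refl refl Prefix.++ right b)) , x≢w)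
  , (subst (Suffix _≡_ x) (sym (suffix b)) (Suffix.fromView (left b Suffix.++ Pointwise.refl refl)) , x≢w)
  where
  x≢w : x ≢ w
  x≢w refl = n≮n _ (proper b)

border-trans : Border x y → Border y w → Border x w
border-trans {x = x} b c = record
  { prefix   = trans (prefix c) (trans (cong (_++ right c) (prefix b)) (++-assoc x _ _))
  ; suffix   = trans (suffix c) (trans (cong (left c ++_) (suffix b)) (sym (++-assoc (left c) _ _)))
  ; nonempty = nonempty b
  ; proper   = <-trans (proper b) (proper c)
  }

∣left∣+∣x∣ : (b : Border x w) → length (left b) + length x ≡ length w
∣left∣+∣x∣ b = sym (trans (cong length (suffix b)) (length-++ (left b)))

-- Both words occur at each end of `w`, so `levi` applied at either end places the shorter one
-- inside the longer one.
border-restrict : Border x w → Border y w → length x < length y → Border x y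
border-restrict {x = x} {w = w} {y = y} b c x<y = record
  { prefix   = proj₁ (proj₂ (levi x (trans (sym (prefix b)) (prefix c)) (<⇒≤ x<y)))
  ; suffix   = proj₂ (proj₂ (levi (left c) (trans (sym (suffix c)) (suffix b)) left≤))
  ; nonempty = nonempty b
  ; proper   = x<y
  }
  where
  open ≤-Reasoning
  left≤ : length (left c) ≤ length (left b)
  left≤ = +-cancelʳ-≤ (length y) _ _ (begin
    length (left c) + length y ≡⟨ trans (∣left∣+∣x∣ c) (sym (∣left∣+∣x∣ b)) ⟩
    length (left b) + length x ≤⟨ +-monoʳ-≤ _ (<⇒≤ x<y) ⟩
    length (left b) + length y ∎)

-- The two occurrences of `y` cover more than `w`, so they share a factor `e` that ends the first
-- and begins the second. The equation `right b ≡ right c` is recorded because it lets `w` be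
-- rebuilt from `y` and `e`.
border-overlap : (c : Border y w) → length w < length y + length y →
                 ∃ λ e → Σ[ b ∈ Border e y ] right b ≡ right c × length e + length w ≡ length y + length y
border-overlap {y = y} {w = w} c w<2y =
  let e , y≡le , y≡er = levi (left c) (trans (sym (suffix c)) (prefix c)) (<⇒≤ left<)
      ∣e∣ : length (left c) + length e ≡ length y
      ∣e∣ = sym (trans (cong length y≡le) (length-++ (left c)))
      open ≤-Reasoning
  in e , record
    { prefix   = y≡er
    ; suffix   = y≡le
    ; nonempty = +-cancelˡ-< (length (left c)) _ _ (begin-strict
        length (left c) + 0 ≡⟨ +-identityʳ _ ⟩
        length (left c)     <⟨ left< ⟩
        length y            ≡⟨ ∣e∣ ⟨
        length (left c) + length e ∎)
    ; proper   = +-cancelˡ-< (length (left c)) _ _ (begin-strict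
        length (left c) + length e ≡⟨ ∣e∣ ⟩
        length y                   <⟨ proper c ⟩
        length w                   ≡⟨ ∣left∣+∣x∣ c ⟨
        length (left c) + length y ∎)
    } , refl , (begin-equality
        length e + length w                     ≡⟨ cong (λ l → length e + l) (∣left∣+∣x∣ c) ⟨
        length e + (length (left c) + length y) ≡⟨ +-assoc (length e) _ _ ⟨
        length e + length (left c) + length y   ≡⟨ cong (_+ length y) (trans (+-comm (length e) _) ∣e∣) ⟩
        length y + length y                     ∎)
  where
  left< : length (left c) < length y
  left< = +-cancelʳ-< (length y) _ _ (subst (_< length y + length y) (sym (∣left∣+∣x∣ c)) w<2y)

-- Borders determined by their length

take-++-length : ∀ {A : Set} (a b : List A) → take (length a) (a ++ b) ≡ a
take-++-length []      b = refl
take-++-length (x ∷ a) b = cong (x ∷_) (take-++-length a b)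

drop-++-length : ∀ {A : Set} (a b : List A) → drop (length a) (a ++ b) ≡ b
drop-++-length []      b = refl
drop-++-length (x ∷ a) b = drop-++-length a b

take-border : Border x w → take (length x) w ≡ x
take-border {x = x} b = trans (cong (take (length x)) (prefix b)) (take-++-length x _)

border-≡ : Border x w → Border y w → length x ≡ length y → x ≡ y
border-≡ {w = w} b c eq = trans (sym (take-border b)) (trans (cong (λ i → take i w) eq) (take-border c))

border? : (x w : Word k) → Dec (Border x w)
border? x w = map′ toBorder fromBorder (isBorder? x w)

-- The last `x` leaves at least `length x` letters before it, so the first `x` fits inside `left b`;
-- the remainder of `left b` is the middle word.
border-split : Border x w → length x + length x ≤ length w → ∃ λ z → w ≡ x ++ z ++ x
border-split {x = x} {w = w} b 2x≤w =
  let z , left≡xz , _ = levi x (trans (sym (prefix b)) (suffix b)) x≤left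
  in z , trans (suffix b) (trans (cong (_++ x) left≡xz) (++-assoc x z x))
  where
  x≤left : length x ≤ length (left b)
  x≤left = +-cancelʳ-≤ (length x) _ _ (subst (length x + length x ≤_) (sym (∣left∣+∣x∣ b)) 2x≤w)

-- Shortest and second-shortest borders

-- Otherwise the two occurrences of `x` would overlap in a border of `x`.
unbordered⇒short : Border x w → Unbordered x → length x + length x ≤ length w
unbordered⇒short {x = x} {w = w} b x-unb with length x + length x ≤? length w
... | yes 2x≤w = 2x≤w
... | no  2x≰w =
  let e , c , _ = border-overlap b (≰⇒> 2x≰w)
  in contradiction (e , fromBorder c) x-unb

module _ {t} (w-uniq : HasUniqueBorderOfLength t w) where

  theBorder : Word _
  theBorder = proj₁ (proj₁ w-uniq)

  theBorder-isBorder : Border theBorder w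
  theBorder-isBorder = toBorder (proj₁ (proj₂ (proj₁ w-uniq)))

  ∣theBorder∣ : length theBorder ≡ t
  ∣theBorder∣ = proj₂ w-uniq

  theBorder-unique : Border y w → theBorder ≡ y
  theBorder-unique = proj₂ (proj₂ (proj₁ w-uniq)) ∘ fromBorder

  ∣border∣≡ : Border y w → length y ≡ t
  ∣border∣≡ b = trans (cong length (sym (theBorder-unique b))) ∣theBorder∣

  -- A border of the unique border would be another, strictly shorter border of `w`.
  theBorder-unbordered : Unbordered theBorder
  theBorder-unbordered (y , c) =
    let b = toBorder c
    in <⇒≢ (proper b) (cong length (sym (theBorder-unique (border-trans b theBorder-isBorder))))

  t<∣w∣ : t < length w
  t<∣w∣ = subst (_< length w) ∣theBorder∣ (proper theBorder-isBorder)

  2t≤∣w∣ : t + t ≤ length w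
  2t≤∣w∣ = subst (λ l → l + l ≤ length w) ∣theBorder∣
    (unbordered⇒short theBorder-isBorder theBorder-unbordered)

-- Replacing w by any further border of w shortens it, so this ends at the second-shortest border of w.
unique-or-second : ∀ n → length w < n → Border x w → Unbordered x →
  HasUniqueBorderOfLength (length x) w ⊎ ∃ λ y → Border y w × HasUniqueBorderOfLength (length x) y
unique-or-second {w = w} {x = x} (suc n) (s≤s w≤n) b x-unb
  with any? (λ y → border? y w ×-dec ¬? (x ≟ʷ y)) (inits w)
... | no none = inj₁
  ( (x , fromBorder b , λ {y} c → decidable-stable (x ≟ʷ y)
      (λ x≢y → none (lose (border∈inits c) (toBorder c , x≢y))))
  , refl)
... | yes some with y , _ , c , x≢y ← find some with <-cmp (length x) (length y)
... | tri≈ _ ∣x∣≡∣y∣ _ = contradiction (border-≡ b c ∣x∣≡∣y∣) x≢y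
... | tri> _ _ y<x = contradiction (y , fromBorder (border-restrict c b y<x)) x-unb
... | tri< x<y _ _ with unique-or-second n (<-≤-trans (proper c) w≤n) (border-restrict b c x<y) x-unb
... | inj₁ y-uniq           = inj₂ (y , c , y-uniq)
... | inj₂ (z , d , z-uniq) = inj₂ (z , border-trans d c , z-uniq)

-- A word has at most one border of each length, so a border can be named by its length. With
-- `Unbordered` for `Q` it is the shortest border of `w`; with `HasUniqueBorderOfLength t` it is the
-- second-shortest, above a shortest one of length `t`.
HasBorder : ℕ → Pred (Word k) 0ℓ → Pred (Word k) 0ℓ
HasBorder i Q w = Border (take i w) w × Q (take i w)

hasBorder? : ∀ i {Q : Pred (Word k) 0ℓ} → Decidable Q → Decidable (HasBorder i Q)
hasBorder? i Q? w = border? (take i w) w ×-dec Q? (take i w)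

hasBorder : ∀ {i} (Q : Pred (Word k) 0ℓ) → length x ≡ i → Border x w → Q x → HasBorder i Q w
hasBorder {x = x} {w = w} Q refl b q =
  subst (λ v → Border v w × Q v) (sym (take-border b)) (b , q)

-- A border is proper, so truncation in take cannot occur.
∣take-border∣ : ∀ i → Border (take i w) w → length (take i w) ≡ i
∣take-border∣ {w = w} i b with i ≤? length w
... | yes i≤w = trans (length-take i w) (m≤n⇒m⊓n≡m i≤w)
... | no  i≰w = contradiction
  (trans (length-take i w) (m≥n⇒m⊓n≡n (<⇒≤ (≰⇒> i≰w)))) (<⇒≢ (proper b))

unique⇒shortest : ∀ t → HasUniqueBorderOfLength t w → HasBorder t Unbordered w
unique⇒shortest t w-uniq =
  hasBorder Unbordered (∣theBorder∣ w-uniq) (theBorder-isBorder w-uniq) (theBorder-unbordered w-uniq)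

second⇒shortest : ∀ t → Border y w → HasUniqueBorderOfLength t y → HasBorder t Unbordered w
second⇒shortest t c y-uniq = hasBorder Unbordered (∣theBorder∣ y-uniq)
  (border-trans (theBorder-isBorder y-uniq) c) (theBorder-unbordered y-uniq)

-- As a border of `w`, `y` has length `t`; but a word with a border of length `t` is longer than
-- `t`.
unique⇒no-second : ∀ t → HasUniqueBorderOfLength t w → Border y w → ¬ HasUniqueBorderOfLength t y
unique⇒no-second t w-uniq c y-uniq = <⇒≢ (t<∣w∣ y-uniq) (sym (∣border∣≡ w-uniq c))

-- If the lengths differed, the shorter border would be a border of the longer one, which
-- `unique⇒no-second` excludes.
second-unique : ∀ t {y z} → Border y w → HasUniqueBorderOfLength t y →
                Border z w → HasUniqueBorderOfLength t z → length y ≡ length z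
second-unique t {y} {z} b y-uniq c z-uniq with <-cmp (length y) (length z)
... | tri≈ _ eq _ = eq
... | tri< y<z _ _ = contradiction y-uniq (unique⇒no-second t z-uniq (border-restrict b c y<z))
... | tri> _ _ z<y = contradiction z-uniq (unique⇒no-second t y-uniq (border-restrict c b z<y))

-- If the two copies of `y` overlap, the overlap is a border of `y` and so has length `t`.
second-length : ∀ t → Border y w → HasUniqueBorderOfLength t y →
                length y + length y ≤ length w ⊎ t + length w ≡ length y + length y
second-length {y = y} {w = w} t c y-uniq with length y + length y ≤? length w
... | yes 2y≤w = inj₁ 2y≤w
... | no  2y≰w =
  let e , d , _ , eq = border-overlap c (≰⇒> 2y≰w)
  in inj₂ (trans (cong (_+ length w) (sym (∣border∣≡ y-uniq d))) eq)

-- Counting with repetition-free lists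

length-set : ∀ {A : Set} {xs ys : List A} → Unique xs → Unique ys →
             (∀ {x} → x ∈ xs → x ∈ ys) → (∀ {x} → x ∈ ys → x ∈ xs) → length xs ≡ length ys
length-set xs! ys! to from = ↭-length (∼bag⇒↭ (unique∧set⇒bag xs! ys! (mk⇔ to from)))

-- The maps need to be inverse only on members of the lists: cutting and gluing words undo each
-- other only for suitable words.
length-bijection : ∀ {A C : Set} {xs : List A} {ys : List C} (f : A → C) (g : C → A) →
  Unique xs → Unique ys →
  (∀ {x} → x ∈ xs → f x ∈ ys × g (f x) ≡ x) → (∀ {y} → y ∈ ys → g y ∈ xs × f (g y) ≡ y) →
  length xs ≡ length ys
length-bijection {xs = xs} {ys} f g xs! ys! to from =
  trans (sym (length-map f xs)) (length-set fxs! ys! to′ from′)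
  where
  gfxs≡xs : map g (map f xs) ≡ xs
  gfxs≡xs = trans (sym (map-∘ xs)) (map-id-local (All.tabulate (proj₂ ∘ to)))
  -- Injectivity of `f` is known only on `xs`, so distinctness is pulled back along `g` from
  -- `map g (map f xs)`, which is `xs`.
  fxs! : Unique (map f xs)
  fxs! = AllPairs.map (λ gx≢gy → gx≢gy ∘ cong g)
    (AllPairs.map⁻ (subst Unique (sym gfxs≡xs) xs!))
  to′ : ∀ {y} → y ∈ map f xs → y ∈ ys
  to′ y∈ with x , x∈ , refl ← ∈-map⁻ f y∈ = proj₁ (to x∈)
  from′ : ∀ {y} → y ∈ ys → y ∈ map f xs
  from′ y∈ = subst (_∈ map f xs) (proj₂ (from y∈)) (∈-map⁺ f (proj₁ (from y∈)))

length-cartesianProductWith : ∀ {A C D : Set} (f : A → C → D) xs ys →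
  length (cartesianProductWith f xs ys) ≡ length xs * length ys
length-cartesianProductWith f []       ys = refl
length-cartesianProductWith f (x ∷ xs) ys = trans (length-++ (map (f x) ys))
  (cong₂ _+_ (length-map (f x) ys) (length-cartesianProductWith f xs ys))

length-words : ∀ k n → length (words k n) ≡ k ^ n
length-words k zero    = refl
length-words k (suc n) = trans (length-cartesianProductWith _∷_ (allFin k) (words k n))
  (cong₂ _*_ (length-tabulate {n = k} (λ i → i)) (length-words k n))

length-concatMap : ∀ {A C : Set} (f : A → List C) xs →
  length (concatMap f xs) ≡ sum (map (length ∘ f) xs)
length-concatMap f []       = refl
length-concatMap f (x ∷ xs) = trans (length-++ (f x)) (cong (λ l → length (f x) + l) (length-concatMap f xs))

module _ {Q : Pred (Word k) 0ℓ} (Q? : Decidable Q) where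

  counted : ℕ → List (Word k)
  counted n = filter Q? (words k n)

  counted-unique : ∀ n → Unique (counted n)
  counted-unique n = Unique.filter⁺ Q? (words-unique k n)

  counted⁺ : ∀ {n} → length w ≡ n → Q w → w ∈ counted n
  counted⁺ {n = n} ∣w∣≡n = ∈-filter⁺ Q? (words-complete n ∣w∣≡n)

  counted⁻ : ∀ n → w ∈ counted n → length w ≡ n × Q w
  counted⁻ n w∈ with w∈words , q ← ∈-filter⁻ Q? w∈ = words-sound n w∈words , q

-- Words with a prescribed border

-- The two copies of the border do not overlap, so such a word is `x ++ z ++ x` with `x` of length
-- `i` satisfying `Q` and `z` an arbitrary word of length `r`, chosen independently.
count-split : ∀ {Q : Pred (Word k) 0ℓ} (Q? : Decidable Q) i r {n} → 0 < i → i + (r + i) ≡ n →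
              countWords (hasBorder? i Q?) n ≡ countWords Q? i * k ^ r
count-split {k = k} {Q} Q? i r {n} 0<i i+r+i≡n = begin
  length (counted (hasBorder? i Q?) n)
    ≡⟨ length-bijection glue cut (Unique.cartesianProduct⁺ (counted-unique Q? i) (words-unique k r))
         (counted-unique (hasBorder? i Q?) n) glued cutted ⟨
  length (cartesianProduct (counted Q? i) (words k r))
    ≡⟨ length-cartesianProductWith _,_ (counted Q? i) (words k r) ⟩
  length (counted Q? i) * length (words k r)
    ≡⟨ cong (length (counted Q? i) *_) (length-words k r) ⟩
  length (counted Q? i) * k ^ r ∎
  where
  open ≡-Reasoning
  glue : Word k × Word k → Word k
  glue (x , z) = x ++ z ++ x
  cut : Word k → Word k × Word k
  cut w = take i w , take r (drop i w)

  cut-glue : ∀ {x z} → length x ≡ i → length z ≡ r → cut (glue (x , z)) ≡ (x , z)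
  cut-glue {x} {z} refl refl
    rewrite take-++-length x (z ++ x) | drop-++-length x (z ++ x) | take-++-length z x = refl

  ∣glue∣ : ∀ x z → length (glue (x , z)) ≡ length x + (length z + length x)
  ∣glue∣ x z = trans (length-++ x) (cong (λ l → length x + l) (length-++ z))

  glued : ∀ {p} → p ∈ cartesianProduct (counted Q? i) (words k r) →
          glue p ∈ counted (hasBorder? i Q?) n × cut (glue p) ≡ p
  glued {x , z} p∈
    with x∈ , z∈ ← ∈-cartesianProduct⁻ (counted Q? i) (words k r) p∈
    with refl , q ← counted⁻ Q? i x∈ | refl ← words-sound r z∈ =
      counted⁺ (hasBorder? i Q?) (trans (∣glue∣ x z) i+r+i≡n) (hasBorder Q refl glue-border q)
    , cut-glue refl refl
    where
    glue-border : Border x (glue (x , z))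
    glue-border = record
      { prefix   = refl
      ; suffix   = sym (++-assoc x z x)
      ; nonempty = 0<i
      ; proper   = subst (length x <_) (sym (∣glue∣ x z))
          (m<m+n (length x) (<-≤-trans 0<i (m≤n+m (length x) (length z))))
      }

  cutted : ∀ {w} → w ∈ counted (hasBorder? i Q?) n →
           cut w ∈ cartesianProduct (counted Q? i) (words k r) × glue (cut w) ≡ w
  cutted {w} w∈
    with ∣w∣≡n , b , q ← counted⁻ (hasBorder? i Q?) n w∈
    with ∣x∣≡i ← ∣take-border∣ i b
    with z , w≡xzx ← border-split b (subst₂ _≤_ (cong₂ _+_ (sym ∣x∣≡i) (sym ∣x∣≡i)) (sym ∣w∣≡n)
                       (subst (i + i ≤_) i+r+i≡n (+-monoʳ-≤ i (m≤n+m i r))))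
    = subst (_∈ cartesianProduct (counted Q? i) (words k r)) (sym cut≡)
        (∈-cartesianProduct⁺ (counted⁺ Q? ∣x∣≡i q) (words-complete r ∣z∣≡r))
    , trans (cong glue cut≡) (sym w≡xzx)
    where
    v : Word k
    v = take i w
    ∣z∣≡r : length z ≡ r
    ∣z∣≡r = +-cancelʳ-≡ i _ _ (+-cancelˡ-≡ i _ _ (begin
      i + (length z + i)               ≡⟨ cong₂ (λ l m → l + (length z + m)) ∣x∣≡i ∣x∣≡i ⟨
      length v + (length z + length v) ≡⟨ ∣glue∣ v z ⟨
      length (glue (v , z))            ≡⟨ cong length w≡xzx ⟨
      length w                         ≡⟨ ∣w∣≡n ⟩
      n                                ≡⟨ i+r+i≡n ⟨
      i + (r + i)                      ∎))
    cut≡ : cut w ≡ (v , z)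
    cut≡ = trans (cong cut w≡xzx) (cut-glue ∣x∣≡i ∣z∣≡r)

-- Here `m` exceeds half of `n`, so the two copies of the border `y` overlap in the unique border of
-- `y`. Hence the word is `y` followed by `y` without its first `t` letters.
count-overlap : ∀ t m {n} → 0 < t → t < n → t + n ≡ m + m →
                countWords {k} (hasBorder? m (hasUniqueBorderOfLength? t)) n ≡ B k m t
count-overlap {k} t m {n} 0<t t<n t+n≡2m =
  sym (length-bijection double (take m) (counted-unique uniq? m)
    (counted-unique (hasBorder? m uniq?) n) doubled halved)
  where
  uniq? : Decidable (HasUniqueBorderOfLength {k} t)
  uniq? = hasUniqueBorderOfLength? t
  double : Word k → Word k
  double y = y ++ drop t y

  -- From `n ≤ m` would follow `n + n ≤ m + m`, which is `t + n` and hence less than `n + n`.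
  m<n : m < n
  m<n = ≰⇒> λ n≤m → <⇒≱ (+-monoˡ-< n t<n) (subst (n + n ≤_) (sym t+n≡2m) (+-mono-≤ n≤m n≤m))

  drop-border : ∀ {x y : Word k} (b : Border x y) → length x ≡ t → drop t y ≡ right b
  drop-border {x} b refl = trans (cong (drop t) (prefix b)) (drop-++-length x (right b))

  doubled : ∀ {y} → y ∈ counted uniq? m →
            double y ∈ counted (hasBorder? m uniq?) n × take m (double y) ≡ y
  doubled {y} y∈ with refl , y-uniq ← counted⁻ uniq? m y∈ =
      counted⁺ (hasBorder? m uniq?) ∣double∣ (hasBorder (HasUniqueBorderOfLength t) refl double-border y-uniq)
    , take-++-length y _
    where
    b : Border (theBorder y-uniq) y
    b = theBorder-isBorder y-uniq
    dy≡right : drop t y ≡ right b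
    dy≡right = drop-border b (∣theBorder∣ y-uniq)
    ∣double∣ : length (double y) ≡ n
    ∣double∣ = +-cancelˡ-≡ t _ _ (begin
      t + length (y ++ drop t y)         ≡⟨ cong (λ l → t + l) (length-++ y) ⟩
      t + (length y + length (drop t y)) ≡⟨ cong (λ l → t + (length y + l)) (length-drop t y) ⟩
      t + (length y + (length y ∸ t))    ≡⟨ cong (λ l → t + l) (+-∸-assoc (length y) (<⇒≤ (t<∣w∣ y-uniq))) ⟨
      t + (length y + length y ∸ t)      ≡⟨ cong (λ l → t + (l ∸ t)) t+n≡2m ⟨
      t + (t + n ∸ t)                    ≡⟨ cong (λ l → t + l) (m+n∸m≡n t n) ⟩
      t + n                              ∎)
      where open ≡-Reasoning
    double-border : Border y (double y)
    double-border = record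
      { prefix   = refl
      -- The border of `y` is shared by both copies: read as the end of the first `y`, it is
      -- regrouped as the beginning of the second.
      ; suffix   = begin
          y ++ drop t y                           ≡⟨ cong₂ _++_ (suffix b) dy≡right ⟩
          (left b ++ theBorder y-uniq) ++ right b ≡⟨ ++-assoc (left b) _ _ ⟩
          left b ++ theBorder y-uniq ++ right b   ≡⟨ cong (left b ++_) (prefix b) ⟨
          left b ++ y                             ∎
      ; nonempty = <-trans 0<t (t<∣w∣ y-uniq)
      ; proper   = subst (length y <_) (sym ∣double∣) m<n
      }
      where open ≡-Reasoning

  halved : ∀ {w} → w ∈ counted (hasBorder? m uniq?) n →
           take m w ∈ counted uniq? m × double (take m w) ≡ w
  halved {w} w∈
    with refl , c , y-uniq ← counted⁻ (hasBorder? m uniq?) n w∈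
    with ∣y∣≡m ← ∣take-border∣ m c
    with e , b , right≡ , _ ← border-overlap c (subst (length w <_)
                                (trans t+n≡2m (cong₂ _+_ (sym ∣y∣≡m) (sym ∣y∣≡m))) (m<n+m _ 0<t))
    = counted⁺ uniq? ∣y∣≡m y-uniq
    , trans (cong (take m w ++_) (trans (drop-border b (∣border∣≡ y-uniq b)) right≡)) (sym (prefix c))

-- Classification by the second-shortest border

-- The list `is` of possible second lengths is a parameter because the parity of `n + t` decides
-- whether the overlapping length belongs to it. The classes are disjoint by `second-unique` and
-- `unique⇒no-second`, and exhaustive by `unique-or-second`.
count-shortest : ∀ t n is → Unique is →
  (∀ {w y : Word k} → length w ≡ n → Border y w → HasUniqueBorderOfLength t y → length y ∈ is) →
  countWords {k} (hasBorder? t unbordered?) n ≡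
    B k n t + sum (map (λ i → countWords {k} (hasBorder? i (hasUniqueBorderOfLength? t)) n) is)
count-shortest {k} t n is is! complete = begin
  length (counted shortest? n)
    ≡⟨ length-set (counted-unique shortest? n)
         (Unique.++⁺ (counted-unique uniq? n) seconds! disjoint) to from ⟩
  length (counted uniq? n ++ concatMap second is)
    ≡⟨ length-++ (counted uniq? n) ⟩
  length (counted uniq? n) + length (concatMap second is)
    ≡⟨ cong (λ l → B k n t + l) (length-concatMap second is) ⟩
  B k n t + sum (map (length ∘ second) is) ∎
  where
  open ≡-Reasoning
  uniq? : Decidable (HasUniqueBorderOfLength {k} t)
  uniq? = hasUniqueBorderOfLength? t
  shortest? : Decidable (HasBorder {k} t Unbordered)
  shortest? = hasBorder? t unbordered?
  second : ℕ → List (Word k)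
  second i = counted (hasBorder? i uniq?) n

  second⁻ : ∀ {w} → w ∈ concatMap second is →
            ∃ λ i → i ∈ is × length w ≡ n × HasBorder i (HasUniqueBorderOfLength t) w
  second⁻ w∈ with _ , w∈s , s∈ ← ∈-concat⁻′ (map second is) w∈
    with i , i∈ , refl ← ∈-map⁻ second s∈ = i , i∈ , counted⁻ (hasBorder? i uniq?) n w∈s

  seconds! : Unique (concatMap second is)
  seconds! = Unique.concat⁺
    (All.map⁺ (All.universal (λ i → counted-unique (hasBorder? i uniq?) n) is))
    (AllPairs.map⁺ (AllPairs.map (λ {i} {j} → second-disjoint {i} {j}) is!))
    where
    second-disjoint : ∀ {i j} → i ≢ j → Disjoint (second i) (second j)
    second-disjoint {i} {j} i≢j (w∈i , w∈j)
      with _ , b , b-uniq ← counted⁻ (hasBorder? i uniq?) n w∈i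
         | _ , c , c-uniq ← counted⁻ (hasBorder? j uniq?) n w∈j =
      i≢j (trans (sym (∣take-border∣ i b))
            (trans (second-unique t b b-uniq c c-uniq) (∣take-border∣ j c)))

  disjoint : Disjoint (counted uniq? n) (concatMap second is)
  disjoint (w∈ , w∈s) with _ , w-uniq ← counted⁻ uniq? n w∈ | i , _ , _ , c , y-uniq ← second⁻ w∈s =
    unique⇒no-second t w-uniq c y-uniq

  to : ∀ {w} → w ∈ counted shortest? n → w ∈ counted uniq? n ++ concatMap second is
  to {w} w∈
    with ∣w∣≡n , b , x-unb ← counted⁻ shortest? n w∈
    -- `≤-refl` sets the bound of the recursion to `suc (length w)`.
    with unique-or-second _ ≤-refl b x-unb
  ... | inj₁ w-uniq =
    ∈-++⁺ˡ (counted⁺ uniq? ∣w∣≡n (subst (λ l → HasUniqueBorderOfLength l w) (∣take-border∣ t b) w-uniq))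
  ... | inj₂ (y , c , y-uniq)
    with y-uniq′ ← subst (λ l → HasUniqueBorderOfLength l y) (∣take-border∣ t b) y-uniq =
    ∈-++⁺ʳ (counted uniq? n) (∈-concat⁺′
      (counted⁺ (hasBorder? (length y) uniq?) ∣w∣≡n (hasBorder (HasUniqueBorderOfLength t) refl c y-uniq′))
      (∈-map⁺ second (complete ∣w∣≡n c y-uniq′)))

  from : ∀ {w} → w ∈ counted uniq? n ++ concatMap second is → w ∈ counted shortest? n
  from w∈ with ∈-++⁻ (counted uniq? n) w∈
  ... | inj₁ w∈u with ∣w∣≡n , w-uniq ← counted⁻ uniq? n w∈u =
    counted⁺ shortest? ∣w∣≡n (unique⇒shortest t w-uniq)
  ... | inj₂ w∈s with i , _ , ∣w∣≡n , c , y-uniq ← second⁻ w∈s =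
    counted⁺ shortest? ∣w∣≡n (second⇒shortest t c y-uniq)

-- Index ranges and integer subtraction

count-split-∸ : ∀ {Q : Pred (Word k) 0ℓ} (Q? : Decidable Q) i n → 0 < i → 2 * i ≤ n →
                countWords (hasBorder? i Q?) n ≡ countWords Q? i * k ^ (n ∸ 2 * i)
count-split-∸ Q? i n 0<i 2i≤n = count-split Q? i (n ∸ 2 * i) 0<i (begin
  i + (n ∸ 2 * i + i)   ≡⟨ cong (λ l → i + l) (+-comm (n ∸ 2 * i) i) ⟩
  i + (i + (n ∸ 2 * i)) ≡⟨ +-assoc i i _ ⟨
  i + i + (n ∸ 2 * i)   ≡⟨ cong (λ l → i + l + (n ∸ 2 * i)) (+-identityʳ i) ⟨
  2 * i + (n ∸ 2 * i)   ≡⟨ m+[n∸m]≡n 2i≤n ⟩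
  n                     ∎)
  where open ≡-Reasoning

-- Converts additive identities between counts in `ℕ` into the integer differences of the theorem.
m+n-n≡m : ∀ m n → + (m + n) - + n ≡ + m
m+n-n≡m m n = trans (ℤ.m-n≡m⊖n (m + n) n) (trans (ℤ.⊖-≥ (m≤n+m n m)) (cong +_ (m+n∸n≡m m n)))

-- The indices over which `∑[ a ⋯ b ]` sums, as a list whose membership can be reasoned about.
range : ℕ → ℕ → List ℕ
range a b = map (λ j → a + j) (upTo (suc b ∸ a))

range-unique : ∀ a b → Unique (range a b)
range-unique a b = Unique.map⁺ (+-cancelˡ-≡ a _ _) (Unique.upTo⁺ (suc b ∸ a))

∈-range⁺ : ∀ {a b i} → a ≤ i → i ≤ b → i ∈ range a b
∈-range⁺ {a} {b} a≤i i≤b = subst (_∈ range a b) (m+[n∸m]≡n a≤i)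
  (∈-map⁺ (λ j → a + j) (∈-upTo⁺ (∸-monoˡ-< (s≤s i≤b) a≤i)))

∈-range⁻ : ∀ {a b i} → i ∈ range a b → a ≤ i × i ≤ b
∈-range⁻ {a} {b} i∈ with j , j∈ , refl ← ∈-map⁻ (λ j → a + j) i∈ =
  m≤m+n a j , ≤-pred (subst (_≤ suc b) (+-suc a j) (subst (a + suc j ≤_) (m+[n∸m]≡n a≤1+b) (+-monoʳ-≤ a j<)))
  where
  j< : j < suc b ∸ a
  j< = ∈-upTo⁻ j∈
  -- Since `j` lies below `suc b ∸ a`, this difference is positive and the subtraction is not
  -- truncated.
  a≤1+b : a ≤ suc b
  a≤1+b = <⇒≤ (m∸n≢0⇒n<m (m<n⇒n≢0 j<))

2*≡+ : ∀ m → 2 * m ≡ m + m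
2*≡+ m = cong (λ l → m + l) (+-identityʳ m)

half≤ : ∀ i {n} → i + i ≤ n → i ≤ n / 2
half≤ i 2i≤n = subst (_≤ _) (m*n/n≡m i 2)
  (/-monoˡ-≤ 2 (≤-trans (≤-reflexive (trans (*-comm i 2) (2*≡+ i))) 2i≤n))

≤half : ∀ {i n} → i ≤ n / 2 → 2 * i ≤ n
≤half {i} {n} i≤ = ≤-trans (*-monoʳ-≤ 2 i≤) (subst (_≤ n) (*-comm (n / 2) 2) (m/n*n≤m n 2))

-- Each index satisfies `1 ≤ 2 * t ≤ i` and `2 * i ≤ n`, so `count-split-∸` applies term by term.
sum-seconds : ∀ k n t → 1 ≤ t →
  sum (map (λ i → countWords {k} (hasBorder? i (hasUniqueBorderOfLength? t)) n) (range (2 * t) (n / 2)))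
  ≡ ∑[ 2 * t ⋯ n / 2 ] (λ i → B k i t * k ^ (n ∸ 2 * i))
sum-seconds k n t 1≤t = cong sum (trans
  (map-cong-local (All.tabulate λ {i} i∈ → let 2t≤i , i≤ = ∈-range⁻ i∈ in
    count-split-∸ (hasUniqueBorderOfLength? t) i n (≤-trans (*-mono-≤ {1} {2} (s≤s z≤n) 1≤t) 2t≤i) (≤half i≤)))
  (sym (map-∘ (upTo (suc (n / 2) ∸ 2 * t)))))

-- The lower end `2 * t` comes from `y` itself, whose unique border of length `t` cannot overlap its
-- other copy in `y`.
second-cases : ∀ t {n} {y w : Word k} → length w ≡ n → Border y w → HasUniqueBorderOfLength t y →
               length y ∈ range (2 * t) (n / 2) ⊎ t + n ≡ length y + length y
second-cases t {y = y} refl c y-uniq with second-length t c y-uniq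
... | inj₁ 2y≤w = inj₁ (∈-range⁺ (subst (_≤ length y) (sym (2*≡+ t)) (2t≤∣w∣ y-uniq)) (half≤ (length y) 2y≤w))
... | inj₂ eq   = inj₂ eq

-- The recurrence

short⇒B≡0 : ∀ k n t → n < 2 * t → B k n t ≡ 0
short⇒B≡0 k n t n<2t = cong length (filter-none (hasUniqueBorderOfLength? t)
  (All.tabulate λ w∈ w-uniq → <⇒≱ n<2t
    (subst₂ _≤_ (sym (2*≡+ t)) (words-sound n w∈) (2t≤∣w∣ w-uniq))))

-- An overlapping second border `y` would make `n + t` equal to twice `length y`, so the range alone
-- lists all second lengths.
odd-count : ∀ k n t → 1 ≤ t → 2 * t ≤ n → ¬ (2 ∣ n + t) →
  u k t * k ^ (n ∸ 2 * t) ≡ B k n t + ∑[ 2 * t ⋯ n / 2 ] (λ i → B k i t * k ^ (n ∸ 2 * i))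
odd-count k n t 1≤t 2t≤n odd = begin
  u k t * k ^ (n ∸ 2 * t)
    ≡⟨ count-split-∸ unbordered? t n 1≤t 2t≤n ⟨
  countWords {k} (hasBorder? t unbordered?) n
    ≡⟨ count-shortest t n _ (range-unique (2 * t) (n / 2)) complete ⟩
  _ ≡⟨ cong (λ s → B k n t + s) (sum-seconds k n t 1≤t) ⟩
  _ ∎
  where
  open ≡-Reasoning
  complete : ∀ {w y : Word k} → length w ≡ n → Border y w → HasUniqueBorderOfLength t y →
             length y ∈ range (2 * t) (n / 2)
  complete {y = y} ∣w∣≡n c y-uniq with second-cases t ∣w∣≡n c y-uniq
  ... | inj₁ y∈ = y∈
  ... | inj₂ eq = contradiction
    (divides (length y) (trans (+-comm n t) (trans eq (sym (trans (*-comm (length y) 2) (2*≡+ (length y))))))) odd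

-- The overlapping length `m` joins the second lengths and contributes `B k m t` by `count-overlap`.
even-count : ∀ k n t m → 1 ≤ t → t < n → 2 * t ≤ n → t + n ≡ m + m →
  u k t * k ^ (n ∸ 2 * t) ≡ B k n t + (B k m t + ∑[ 2 * t ⋯ n / 2 ] (λ i → B k i t * k ^ (n ∸ 2 * i)))
even-count k n t m 1≤t t<n 2t≤n t+n≡2m = begin
  u k t * k ^ (n ∸ 2 * t)
    ≡⟨ count-split-∸ unbordered? t n 1≤t 2t≤n ⟨
  countWords {k} (hasBorder? t unbordered?) n
    ≡⟨ count-shortest t n (m ∷ range (2 * t) (n / 2)) (m∉ ∷ range-unique (2 * t) (n / 2)) complete ⟩
  _ ≡⟨ cong (λ s → B k n t + s) (cong₂ _+_ (count-overlap t m 1≤t t<n t+n≡2m) (sum-seconds k n t 1≤t)) ⟩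
  _ ∎
  where
  open ≡-Reasoning
  -- Members of the range are at most half of `n`, whereas `m + m` is `t + n`, which exceeds `n`.
  m∉ : All (m ≢_) (range (2 * t) (n / 2))
  m∉ = All.tabulate λ { i∈ refl → <⇒≱ (m<n+m n 1≤t)
    (subst (_≤ n) (trans (2*≡+ m) (sym t+n≡2m)) (≤half (proj₂ (∈-range⁻ {2 * t} i∈)))) }
  halve : ∀ l → t + n ≡ l + l → l ≡ m
  halve l eq = *-cancelˡ-≡ l m 2 (trans (2*≡+ l) (trans (sym eq) (trans t+n≡2m (sym (2*≡+ m)))))
  complete : ∀ {w y : Word k} → length w ≡ n → Border y w → HasUniqueBorderOfLength t y →
             length y ∈ m ∷ range (2 * t) (n / 2)
  complete {y = y} ∣w∣≡n c y-uniq with second-cases t ∣w∣≡n c y-uniq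
  ... | inj₁ y∈ = there y∈
  ... | inj₂ eq = here (halve (length y) eq)

-- The differences of counts are taken in the integers, so they do not truncate; in the last two
-- cases the exponents are exact because `2 * t ≤ n` and each index is at most `n / 2`.
theorem9 : ∀ (k n t : ℕ) → 2 ≤ k → 1 ≤ t → t < n →
    (n < 2 * t → B k n t ≡ 0)
    × (2 * t ≤ n → ¬ (2 ∣ n + t) →
        + B k n t ≡ + (u k t * k ^ (n ∸ 2 * t)) - + ∑[ 2 * t ⋯ n / 2 ] (λ i → B k i t * k ^ (n ∸ 2 * i)))
    × (2 * t ≤ n → 2 ∣ n + t →
        + B k n t ≡ + (u k t * k ^ (n ∸ 2 * t)) - + B k ((n + t) / 2) t - + ∑[ 2 * t ⋯ n / 2 ] (λ i → B k i t * k ^ (n ∸ 2 * i)))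
theorem9 k n t _ 1≤t t<n = short⇒B≡0 k n t , odd , even
  where
  S : ℕ
  S = ∑[ 2 * t ⋯ n / 2 ] (λ i → B k i t * k ^ (n ∸ 2 * i))

  odd : 2 * t ≤ n → ¬ (2 ∣ n + t) → + B k n t ≡ + (u k t * k ^ (n ∸ 2 * t)) - + S
  odd 2t≤n 2∤n+t = trans (sym (m+n-n≡m (B k n t) S))
    (cong (λ c → + c - + S) (sym (odd-count k n t 1≤t 2t≤n 2∤n+t)))

  even : 2 * t ≤ n → 2 ∣ n + t →
         + B k n t ≡ + (u k t * k ^ (n ∸ 2 * t)) - + B k ((n + t) / 2) t - + S
  even 2t≤n (divides m n+t≡m*2) = begin
    + B k n t                               ≡⟨ m+n-n≡m (B k n t) S ⟨
    + (B k n t + S) - + S                   ≡⟨ cong (_- + S) (m+n-n≡m (B k n t + S) (B k h t)) ⟨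
    + (B k n t + S + B k h t) - + B k h t - + S
      ≡⟨ cong (λ c → + c - + B k h t - + S) count ⟨
    + (u k t * k ^ (n ∸ 2 * t)) - + B k h t - + S ∎
    where
    open ≡-Reasoning
    h = (n + t) / 2
    h≡m : h ≡ m
    h≡m = trans (cong (_/ 2) n+t≡m*2) (m*n/n≡m m 2)
    t+n≡2h : t + n ≡ h + h
    t+n≡2h = trans (+-comm t n) (trans n+t≡m*2 (trans (*-comm m 2)
      (trans (2*≡+ m) (cong₂ _+_ (sym h≡m) (sym h≡m)))))
    -- `B k h t` is moved to the end so that cancelling from the right follows the order of the
    -- subtractions in the theorem.
    count : u k t * k ^ (n ∸ 2 * t) ≡ B k n t + S + B k h t
    count = trans (even-count k n t h 1≤t t<n 2t≤n t+n≡2h)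
      (trans (cong (λ l → B k n t + l) (+-comm (B k h t) S)) (sym (+-assoc (B k n t) S _)))
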